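{- For $n\geq 2$, let $\mathcal{CG}(S_n)$ be the set of isomorphism classes of groups that occur as critical groups of arithmetical structures on the star graph $S_n$. Then $\lvert\mathcal{CG}(S_n)\rvert\geq 2^{n-2}$.
   Context: An arithmetical structure on a finite, connected, loopless graph $G$ with vertex set $V(G)$ is a pair $(\mathbf{d},\mathbf{r})$, where $\mathbf{r}=(r_v)_{v\in V(G)}$ consists of positive integers with no common factor, $\mathbf{d}=(d_v)_{v\in V(G)}$ consists of nonnegative integers, and for every vertex $v$ we have $r_vd_v=\sum r_u$, the sum being over all $u$ adjacent to $v$ (with multiplicity for multigraphs). Its critical group is the torsion part of the cokernel (over $\mathbb{Z}$) of the matrix $\operatorname{diag}(\mathbf{d})-A(G)$, where $A(G)$ is the adjacency matrix of $G$. The star graph $S_n$ has $n$ leaves, each joined by one edge to a central vertex (and no other edges). -}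

module Defs where

open import Algebra.Bundles using (AbelianGroup)
import Algebra.Construct.Pointwise as Pointwise
import Algebra.Morphism.Construct.Composition as Composition
import Algebra.Morphism.Construct.Identity as Identity
import Algebra.Morphism.GroupMonomorphism as GroupMonomorphism
open import Algebra.Morphism.Bundles using (GroupHomomorphism)
open import Algebra.Morphism.Structures using (module GroupMorphisms)
import Algebra.Properties.AbelianGroup as AbelianGroupProperties
import Algebra.Properties.CommutativeMonoid.Mult as Mult
import Algebra.Properties.CommutativeMonoid.Sum as Sum
open import Data.Bool.Base using (if_then_else_)
open import Data.Fin.Base using (Fin; zero; suc)
open import Data.Fin.Properties using (_≟_)
open import Data.Integer.Base as ℤ using (ℤ; +_)
import Data.Integer.Properties as ℤ
open import Data.Nat.Base as ℕ using (ℕ; zero; suc; NonZero)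
open import Data.Nat.Divisibility using (_∣_)
import Data.Nat.Properties as ℕ
open import Data.Product.Base using (Σ-syntax; ∃-syntax; _×_; _,_; proj₁; proj₂)
open import Function.Base using (_∘_; _on_)
open import Function.Bundles using (Injection)
open import Level using (Level; 0ℓ; _⊔_) renaming (suc to lsuc)
open import Relation.Binary.Bundles using (Setoid)
open import Relation.Binary.Construct.Closure.ReflexiveTransitive
  using (Star; ε; _◅_)
import Relation.Binary.Construct.On as On
open import Relation.Binary.PropositionalEquality as ≡ using (_≡_)
import Relation.Binary.Reasoning.Setoid as SetoidReasoning
open import Relation.Nullary.Decidable.Core using (does)

private
  variable
    a b ℓ₁ ℓ₂ : Level

infix 4 _≅_

_≅_ : AbelianGroup a ℓ₁ → AbelianGroup b ℓ₂ → Set (a ⊔ b ⊔ ℓ₁ ⊔ ℓ₂)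
A ≅ B = Σ[ f ∈ (A.Carrier → B.Carrier) ]
          GroupMorphisms.IsGroupIsomorphism A.rawGroup B.rawGroup f
  where
  module A = AbelianGroup A
  module B = AbelianGroup B

≅-refl : (A : AbelianGroup a ℓ₁) → A ≅ A
≅-refl A = _ , Identity.isGroupIsomorphism rawGroup refl
  where open AbelianGroup A

≅-trans : (A B C : AbelianGroup a ℓ₁) → A ≅ B → B ≅ C → A ≅ C
≅-trans A B C (_ , f-iso) (_ , g-iso) =
  _ , Composition.isGroupIsomorphism (AbelianGroup.trans C) f-iso g-iso

≅-sym : (A : AbelianGroup a ℓ₁) (B : AbelianGroup b ℓ₂) → A ≅ B → B ≅ A
≅-sym A B (f , f-iso) = g , record
  { isGroupMonomorphism = record
    { isGroupHomomorphism = record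
      { isMonoidHomomorphism = record
        { isMagmaHomomorphism = record
          { isRelHomomorphism = record
            { cong = λ {x} {y} x≈y →
                F.injective (B.trans (f∘g x) (B.trans x≈y (B.sym (f∘g y)))) }
          ; homo = λ x y → F.injective
              (B.trans (f∘g (x B.∙ y))
              (B.trans (B.sym (B.∙-cong (f∘g x) (f∘g y)))
                       (B.sym (homo (g x) (g y)))))
          }
        ; ε-homo = F.injective (B.trans (f∘g B.ε) (B.sym F.ε-homo))
        }
      ; ⁻¹-homo = λ x → F.injective
          (B.trans (f∘g (x B.⁻¹))
          (B.trans (B.sym (B.⁻¹-cong (f∘g x)))
                   (B.sym (F.⁻¹-homo (g x)))))
      }
    ; injective = λ {x} {y} gx≈gy →
        B.trans (B.sym (f∘g x)) (B.trans (F.⟦⟧-cong gx≈gy) (f∘g y))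
    }
  ; surjective = λ x → f x , λ {z} z≈fx →
      F.injective (B.trans (f∘g z) z≈fx)
  }
  where
  module A = AbelianGroup A
  module B = AbelianGroup B
  module F = GroupMorphisms.IsGroupIsomorphism f-iso
  open GroupMorphisms.IsGroupHomomorphism F.isGroupHomomorphism using (homo)
  g : B.Carrier → A.Carrier
  g y = proj₁ (F.surjective y)
  f∘g : ∀ y → f (g y) B.≈ y
  f∘g y = proj₂ (F.surjective y) A.refl

module _ (A : AbelianGroup a ℓ₁) (B : AbelianGroup b ℓ₂)
         (φ : GroupHomomorphism (AbelianGroup.rawGroup A)
                                (AbelianGroup.rawGroup B)) where

  private
    module A = AbelianGroup A
    module B = AbelianGroup B
    module φ = GroupHomomorphism φ
    open φ using (⟦_⟧)
    open AbelianGroupProperties B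
      using (⁻¹-anti-homo‿-; ⁻¹-∙-comm)
    open SetoidReasoning B.setoid

  _≈ᶜ_ : B.Carrier → B.Carrier → Set (a ⊔ ℓ₂)
  x ≈ᶜ y = ∃[ z ] ⟦ z ⟧ B.≈ x B.- y

  private
    ≈⇒≈ᶜ : ∀ {x y} → x B.≈ y → x ≈ᶜ y
    ≈⇒≈ᶜ {x} {y} x≈y = A.ε , (begin
      ⟦ A.ε ⟧  ≈⟨ φ.ε-homo ⟩
      B.ε      ≈⟨ B.inverseʳ y ⟨
      y B.- y  ≈⟨ B.∙-congʳ x≈y ⟨
      x B.- y  ∎)

    interchange : ∀ w x y z → (w B.∙ x) B.∙ (y B.∙ z) B.≈ (w B.∙ y) B.∙ (x B.∙ z)
    interchange w x y z = begin
      (w B.∙ x) B.∙ (y B.∙ z)  ≈⟨ B.assoc w x _ ⟩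
      w B.∙ (x B.∙ (y B.∙ z))  ≈⟨ B.∙-congˡ (B.assoc x y z) ⟨
      w B.∙ ((x B.∙ y) B.∙ z)  ≈⟨ B.∙-congˡ (B.∙-congʳ (B.comm x y)) ⟩
      w B.∙ ((y B.∙ x) B.∙ z)  ≈⟨ B.∙-congˡ (B.assoc y x z) ⟩
      w B.∙ (y B.∙ (x B.∙ z))  ≈⟨ B.assoc w y _ ⟨
      (w B.∙ y) B.∙ (x B.∙ z)  ∎

    ≈ᶜ-sym : ∀ {x y} → x ≈ᶜ y → y ≈ᶜ x
    ≈ᶜ-sym {x} {y} (z , eq) = z A.⁻¹ , (begin
      ⟦ z A.⁻¹ ⟧      ≈⟨ φ.⁻¹-homo z ⟩
      ⟦ z ⟧ B.⁻¹      ≈⟨ B.⁻¹-cong eq ⟩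
      (x B.- y) B.⁻¹  ≈⟨ ⁻¹-anti-homo‿- x y ⟩
      y B.- x         ∎)

    ≈ᶜ-trans : ∀ {x y z} → x ≈ᶜ y → y ≈ᶜ z → x ≈ᶜ z
    ≈ᶜ-trans {x} {y} {z} (u , p) (v , q) = u A.∙ v , (begin
      ⟦ u A.∙ v ⟧                        ≈⟨ φ.homo u v ⟩
      ⟦ u ⟧ B.∙ ⟦ v ⟧                    ≈⟨ B.∙-cong p q ⟩
      (x B.- y) B.∙ (y B.- z)            ≈⟨ B.assoc x _ _ ⟩
      x B.∙ (y B.⁻¹ B.∙ (y B.- z))       ≈⟨ B.∙-congˡ (B.assoc _ y _) ⟨
      x B.∙ ((y B.⁻¹ B.∙ y) B.∙ z B.⁻¹)  ≈⟨ B.∙-congˡ (B.∙-congʳ (B.inverseˡ y)) ⟩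
      x B.∙ (B.ε B.∙ z B.⁻¹)             ≈⟨ B.∙-congˡ (B.identityˡ _) ⟩
      x B.- z                            ∎)

    ∙-cong : ∀ {x y u v} → x ≈ᶜ y → u ≈ᶜ v → (x B.∙ u) ≈ᶜ (y B.∙ v)
    ∙-cong {x} {y} {u} {v} (s , p) (t , q) = s A.∙ t , (begin
      ⟦ s A.∙ t ⟧                         ≈⟨ φ.homo s t ⟩
      ⟦ s ⟧ B.∙ ⟦ t ⟧                     ≈⟨ B.∙-cong p q ⟩
      (x B.- y) B.∙ (u B.- v)             ≈⟨ interchange x _ u _ ⟩
      (x B.∙ u) B.∙ (y B.⁻¹ B.∙ v B.⁻¹)   ≈⟨ B.∙-congˡ (⁻¹-∙-comm y v) ⟩
      (x B.∙ u) B.- (y B.∙ v)             ∎)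

    ⁻¹-cong : ∀ {x y} → x ≈ᶜ y → (x B.⁻¹) ≈ᶜ (y B.⁻¹)
    ⁻¹-cong {x} {y} (z , p) = z A.⁻¹ , (begin
      ⟦ z A.⁻¹ ⟧      ≈⟨ φ.⁻¹-homo z ⟩
      ⟦ z ⟧ B.⁻¹      ≈⟨ B.⁻¹-cong p ⟩
      (x B.- y) B.⁻¹  ≈⟨ ⁻¹-∙-comm x _ ⟨
      x B.⁻¹ B.- y B.⁻¹  ∎)

  cokernel : AbelianGroup b (a ⊔ ℓ₂)
  cokernel = record
    { Carrier = B.Carrier
    ; _≈_     = _≈ᶜ_
    ; _∙_     = B._∙_
    ; ε       = B.ε
    ; _⁻¹     = B._⁻¹
    ; isAbelianGroup = record
      { isGroup = record
        { isMonoid = record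
          { isSemigroup = record
            { isMagma = record
              { isEquivalence = record
                { refl  = ≈⇒≈ᶜ B.refl
                ; sym   = ≈ᶜ-sym
                ; trans = ≈ᶜ-trans
                }
              ; ∙-cong = ∙-cong
              }
            ; assoc = λ x y z → ≈⇒≈ᶜ (B.assoc x y z)
            }
          ; identity = ≈⇒≈ᶜ ∘ B.identityˡ , ≈⇒≈ᶜ ∘ B.identityʳ
          }
        ; inverse = ≈⇒≈ᶜ ∘ B.inverseˡ , ≈⇒≈ᶜ ∘ B.inverseʳ
        ; ⁻¹-cong = ⁻¹-cong
        }
      ; comm = λ x y → ≈⇒≈ᶜ (B.comm x y)
      }
    }

module _ (A : AbelianGroup a ℓ₁) where

  private
    module A = AbelianGroup A
    open Mult A.commutativeMonoid using (×-congʳ; ×-assocˡ; ×-congˡ; ×-distrib-+)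
      renaming (_×_ to _·_)
    open SetoidReasoning A.setoid

  IsTorsion : A.Carrier → Set ℓ₁
  IsTorsion x = ∃[ k ] NonZero k × k · x A.≈ A.ε

  private
    ·-zeroʳ : ∀ k → k · A.ε A.≈ A.ε
    ·-zeroʳ zero    = A.refl
    ·-zeroʳ (suc k) = A.trans (A.identityˡ _) (·-zeroʳ k)

    ∙-torsion : ∀ {x y} → IsTorsion x → IsTorsion y → IsTorsion (x A.∙ y)
    ∙-torsion {x} {y} (k , k≢0 , p) (l , l≢0 , q) =
      k ℕ.* l , ℕ.m*n≢0 k l {{k≢0}} {{l≢0}} , (begin
        (k ℕ.* l) · (x A.∙ y)                  ≈⟨ ×-distrib-+ x y (k ℕ.* l) ⟩
        (k ℕ.* l) · x A.∙ (k ℕ.* l) · y        ≈⟨ A.∙-congʳ (×-congˡ (ℕ.*-comm k l)) ⟩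
        (l ℕ.* k) · x A.∙ (k ℕ.* l) · y        ≈⟨ A.∙-cong (×-assocˡ x l k) (×-assocˡ y k l) ⟨
        l · (k · x) A.∙ k · (l · y)            ≈⟨ A.∙-cong (×-congʳ l p) (×-congʳ k q) ⟩
        l · A.ε A.∙ k · A.ε                    ≈⟨ A.∙-cong (·-zeroʳ l) (·-zeroʳ k) ⟩
        A.ε A.∙ A.ε                            ≈⟨ A.identityˡ A.ε ⟩
        A.ε                                    ∎)

    ⁻¹-torsion : ∀ {x} → IsTorsion x → IsTorsion (x A.⁻¹)
    ⁻¹-torsion {x} (k , k≢0 , p) = k , k≢0 , (begin
      k · (x A.⁻¹)               ≈⟨ A.identityʳ _ ⟨
      k · (x A.⁻¹) A.∙ A.ε       ≈⟨ A.∙-congˡ p ⟨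
      k · (x A.⁻¹) A.∙ k · x     ≈⟨ ×-distrib-+ (x A.⁻¹) x k ⟨
      k · (x A.⁻¹ A.∙ x)         ≈⟨ ×-congʳ k (A.inverseˡ x) ⟩
      k · A.ε                    ≈⟨ ·-zeroʳ k ⟩
      A.ε                        ∎)

  torsionSubgroup : AbelianGroup (a ⊔ ℓ₁) ℓ₁
  torsionSubgroup = record
    { Carrier = Σ[ x ∈ A.Carrier ] IsTorsion x
    ; _≈_     = A._≈_ on proj₁
    ; _∙_     = λ (x , p) (y , q) → x A.∙ y , ∙-torsion p q
    ; ε       = A.ε , 1 , _ , A.identityʳ A.ε
    ; _⁻¹     = λ (x , p) → x A.⁻¹ , ⁻¹-torsion p
    ; isAbelianGroup = GroupMonomorphism.isAbelianGroup
        {G₂ = A.rawGroup} {⟦_⟧ = proj₁}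
        (record
          { isGroupHomomorphism = record
            { isMonoidHomomorphism = record
              { isMagmaHomomorphism = record
                { isRelHomomorphism = record { cong = λ x≈y → x≈y }
                ; homo = λ _ _ → A.refl
                }
              ; ε-homo = A.refl
              }
            ; ⁻¹-homo = λ _ → A.refl
            }
          ; injective = λ x≈y → x≈y
          })
        A.isAbelianGroup
    }

Matrix : ℕ → ℕ → Set
Matrix m n = Fin m → Fin n → ℤ

ℤ^_ : ℕ → AbelianGroup 0ℓ 0ℓ
ℤ^ n = Pointwise.abelianGroup (Fin n) ℤ.+-0-abelianGroup

diag : ∀ {n} → (Fin n → ℤ) → Matrix n n
diag d i j = if does (i ≟ j) then d i else ℤ.0ℤ

infixl 6 _-ᴹ_

_-ᴹ_ : ∀ {m n} → Matrix m n → Matrix m n → Matrix m n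
(M -ᴹ N) i j = M i j ℤ.- N i j

module _ {m n : ℕ} (M : Matrix m n) where

  open Sum ℤ.+-0-commutativeMonoid using (sum-syntax; sum-cong-≗; ∑-distrib-+; sum-replicate-zero)

  apply : (Fin n → ℤ) → (Fin m → ℤ)
  apply x i = ∑[ j < n ] (M i j ℤ.* x j)

  private
    apply-cong : ∀ {x y} → (∀ j → x j ≡ y j) → ∀ i → apply x i ≡ apply y i
    apply-cong x≗y i = sum-cong-≗ (λ j → ≡.cong (M i j ℤ.*_) (x≗y j))

    apply-+ : ∀ x y i →
              apply (λ j → x j ℤ.+ y j) i ≡ apply x i ℤ.+ apply y i
    apply-+ x y i = ≡.trans
      (sum-cong-≗ (λ j → ℤ.*-distribˡ-+ (M i j) (x j) (y j)))
      (∑-distrib-+ (λ j → M i j ℤ.* x j) (λ j → M i j ℤ.* y j))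

    apply-0 : ∀ i → apply (λ _ → ℤ.0ℤ) i ≡ ℤ.0ℤ
    apply-0 i = ≡.trans
      (sum-cong-≗ (λ j → ℤ.*-zeroʳ (M i j)))
      (sum-replicate-zero n)

    apply-neg : ∀ x i → apply (λ j → ℤ.- x j) i ≡ ℤ.- apply x i
    apply-neg x i = inverseˡ-unique _ _ (≡.trans
      (≡.sym (apply-+ (λ j → ℤ.- x j) x i))
      (≡.trans (apply-cong (λ j → ℤ.+-inverseˡ (x j)) i) (apply-0 i)))
      where open AbelianGroupProperties ℤ.+-0-abelianGroup using (inverseˡ-unique)

  linearMap : GroupHomomorphism (AbelianGroup.rawGroup (ℤ^ n))
                                (AbelianGroup.rawGroup (ℤ^ m))
  linearMap = record
    { ⟦_⟧ = apply
    ; isGroupHomomorphism = record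
      { isMonoidHomomorphism = record
        { isMagmaHomomorphism = record
          { isRelHomomorphism = record { cong = apply-cong }
          ; homo = apply-+
          }
        ; ε-homo = apply-0
        }
      ; ⁻¹-homo = apply-neg
      }
    }

  matrixCokernel : AbelianGroup 0ℓ 0ℓ
  matrixCokernel = cokernel (ℤ^ n) (ℤ^ m) linearMap

record Graph : Set where
  field
    order     : ℕ
    nonEmpty  : NonZero order
    -- the number of edges joining two vertices
    adj       : Fin order → Fin order → ℕ
    symmetric : ∀ u v → adj u v ≡ adj v u
    loopless  : ∀ v → adj v v ≡ 0
    connected : ∀ u v → Star (λ x y → NonZero (adj x y)) u v

  Vertex : Set
  Vertex = Fin order

  adjacencyMatrix : Matrix order order
  adjacencyMatrix u v = + adj u v

-- Vertex 0 is the centre, the other n vertices are the leaves.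
starGraph : ℕ → Graph
starGraph n = record
  { order     = suc n
  ; nonEmpty  = _
  ; adj       = adj
  ; symmetric = symmetric
  ; loopless  = loopless
  ; connected = connected
  }
  where
  adj : Fin (suc n) → Fin (suc n) → ℕ
  adj zero    zero    = 0
  adj zero    (suc _) = 1
  adj (suc _) zero    = 1
  adj (suc _) (suc _) = 0

  symmetric : ∀ u v → adj u v ≡ adj v u
  symmetric zero    zero    = ≡.refl
  symmetric zero    (suc _) = ≡.refl
  symmetric (suc _) zero    = ≡.refl
  symmetric (suc _) (suc _) = ≡.refl

  loopless : ∀ v → adj v v ≡ 0
  loopless zero    = ≡.refl
  loopless (suc _) = ≡.refl

  fromCentre : ∀ v → Star (λ x y → NonZero (adj x y)) zero v
  fromCentre zero    = ε
  fromCentre (suc _) = _ ◅ ε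

  connected : ∀ u v → Star (λ x y → NonZero (adj x y)) u v
  connected zero    v = fromCentre v
  connected (suc _) v = _ ◅ fromCentre v

module _ (G : Graph) where

  open Graph G
  open Sum ℕ.+-0-commutativeMonoid using (sum-syntax)

  record ArithmeticalStructure : Set where
    field
      d          : Vertex → ℕ
      r          : Vertex → ℕ
      r-positive : ∀ v → NonZero (r v)
      r-coprime  : ∀ k → (∀ v → k ∣ r v) → k ≡ 1
      balanced   : ∀ v → r v ℕ.* d v ≡ ∑[ u < order ] (adj v u ℕ.* r u)

  criticalGroup : ArithmeticalStructure → AbelianGroup 0ℓ 0ℓ
  criticalGroup s =
    torsionSubgroup (matrixCokernel (diag (λ v → + d v) -ᴹ adjacencyMatrix))
    where open ArithmeticalStructure s

  IsCriticalGroup : AbelianGroup 0ℓ 0ℓ → Set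
  IsCriticalGroup A = ∃[ s ] A ≅ criticalGroup s

  -- The set of isomorphism classes, as a setoid whose equality is isomorphism.
  CG : Setoid (lsuc 0ℓ) 0ℓ
  CG = record
    { Carrier = Σ[ A ∈ AbelianGroup 0ℓ 0ℓ ] IsCriticalGroup A
    ; _≈_     = _≅_ on proj₁
    ; isEquivalence = On.isEquivalence proj₁ record
      { refl  = λ {A} → ≅-refl A
      ; sym   = λ {A} {B} → ≅-sym A B
      ; trans = λ {A} {B} {C} → ≅-trans A B C
      }
    }


infix 4 ∣_∣≥_

∣_∣≥_ : Setoid a ℓ₁ → ℕ → Set (a ⊔ ℓ₁)
∣ S ∣≥ k = Injection (≡.setoid (Fin k)) S

{-# OPTIONS --safe #-}

-- Suppose that the leaves of S_n carry the labels d₁, …, d_k, L, L, where k = n − 2,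
-- every dᵢ divides L, and the reciprocals of all n labels add up to an integer.
-- Then the critical group is ℤ/d₁ × … × ℤ/d_k, by x ↦ (xᵢ − x_B)ᵢ where B is one
-- of the two leaves labelled L.
--
-- A word of k bits produces such labels with L = 2m.  Starting from m = 1, one
-- letter appends the label m + 1 and replaces m by m(m + 1); the other appends the
-- label 2m and replaces m by 2m, except that for m = 1 it appends the label 1 and
-- keeps m.  Since 1/m = 1/(m + 1) + 1/(m(m + 1)) = 1/(2m) + 1/(2m), the number
-- Σ 1/dᵢ + 1/m is always an integer.  The order Π dᵢ and the exponent m of the
-- group determine the word, so the 2 ^ k groups are pairwise non-isomorphic.

module Submission where

open import Defs
open import Algebra.Bundles using (AbelianGroup)
open import Algebra.Morphism.Bundles using (GroupHomomorphism)
open import Algebra.Morphism.Structures using (module GroupMorphisms)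
import Algebra.Properties.CommutativeMonoid.Mult as Mult
import Algebra.Properties.CommutativeMonoid.Sum as Sum
import Algebra.Properties.Semiring.Sum as SemiringSum
open import Data.Fin.Base
  using (Fin; zero; suc; toℕ; fromℕ<; combine; remQuot; finToFun; funToFin)
open import Data.Fin.Properties
  using (toℕ<n; toℕ-fromℕ<; toℕ-injective; combine-injective; combine-remQuot;
         funToFin-finToFin; injective⇒≤)
open import Data.Integer.Base as ℤ using (ℤ; +_)
open import Data.Integer.DivMod using (_%ℕ_; _/ℕ_; n%ℕd<d; a≡a%ℕn+[a/ℕn]*n)
import Data.Integer.Divisibility.Signed as ℤ
import Data.Integer.Properties as ℤ
import Data.Integer.Tactic.RingSolver as ℤSolver
open import Data.Nat.Base
open import Data.Nat.Coprimality using (Coprime; coprime-divisor; coprime-+; 1-coprimeTo)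
open import Data.Nat.Divisibility
open import Data.Nat.Properties
open import Data.Nat.Tactic.RingSolver using (solve-∀)
open import Data.Product.Base using (∃-syntax; _×_; _,_; proj₁; proj₂; uncurry)
open import Data.Sum.Base using (_⊎_; inj₁; inj₂)
open import Data.Vec.Functional using (_∷_; tail)
open import Function.Base using (_∘_)
open import Level using (0ℓ)
open import Relation.Binary.Bundles using (Setoid)
open import Relation.Binary.Definitions using (tri<; tri≈; tri>)
open import Relation.Binary.PropositionalEquality
open import Relation.Nullary.Negation using (contradiction)

open Sum *-1-commutativeMonoid using () renaming (sum to ∏)
open SemiringSum +-*-semiring using (sum; sum-cong-≗; sum-replicate-zero; *-distribˡ-sum)
module ∑ = SemiringSum ℤ.+-*-semiring

private
  variable
    k l : ℕ

-- Words, their labels and integrality.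

-- The exception at 1 keeps the words distinguished: there, doubling m and replacing it
-- by m * suc m would have the same effect.
doubling : ℕ → ℕ
doubling 1 = 1
doubling _ = 2

doubling-cases : ∀ m → (m ≡ 1 × doubling m ≡ 1) ⊎ (m ≢ 1 × doubling m ≡ 2)
doubling-cases 0             = inj₂ ((λ ()) , refl)
doubling-cases 1             = inj₁ (refl , refl)
doubling-cases (suc (suc m)) = inj₂ ((λ ()) , refl)

factor : Fin 2 → ℕ → ℕ
factor zero    m = doubling m
factor (suc _) m = suc m

newDenominator : Fin 2 → ℕ → ℕ
newDenominator zero    m = doubling m * m
newDenominator (suc _) m = suc m

newCofactor : Fin 2 → ℕ → ℕ
newCofactor zero    m = 1
newCofactor (suc _) m = m

-- The letter used last is at index zero.
Word : ℕ → Set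
Word k = Fin k → Fin 2

modulus : Word k → ℕ
modulus {zero}  w = 1
modulus {suc k} w = factor (w zero) (modulus (tail w)) * modulus (tail w)

denominator : Word k → Fin k → ℕ
denominator w zero    = newDenominator (w zero) (modulus (tail w))
denominator w (suc i) = denominator (tail w) i

-- The quotient of `modulus w` by `denominator w i`, built without division: each later letter
-- scales the modulus, and with it the earlier quotients, by `factor`.
cofactor : Word k → Fin k → ℕ
cofactor w zero    = newCofactor (w zero) (modulus (tail w))
cofactor w (suc i) = factor (w zero) (modulus (tail w)) * cofactor (tail w) i

newCofactor*newDenominator : ∀ b m → newCofactor b m * newDenominator b m ≡ factor b m * m
newCofactor*newDenominator zero    m = *-identityˡ _
newCofactor*newDenominator (suc _) m = *-comm m (suc m)

cofactor*denominator : (w : Word k) → ∀ i → cofactor w i * denominator w i ≡ modulus w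
cofactor*denominator w zero    = newCofactor*newDenominator (w zero) _
cofactor*denominator w (suc i) = trans
  (*-assoc (factor (w zero) (modulus (tail w))) _ _)
  (cong (factor (w zero) (modulus (tail w)) *_) (cofactor*denominator (tail w) i))

-- With `S` the old sum of cofactors, the left side is `factor b m * suc S`, so `s` survives. In the
-- exceptional case the appended label 1 adds 1 to the sum of reciprocals, and `s` becomes `suc s`.
step-integral : ∀ b m S s → suc S ≡ s * m →
                ∃[ s′ ] suc (newCofactor b m + factor b m * S) ≡ s′ * (factor b m * m)
step-integral (suc _) m S s eq = s , trans (expand m S) (trans (cong (suc m *_) eq) (swap m s))
  where
  expand : ∀ m S → suc (m + suc m * S) ≡ suc m * suc S
  expand = solve-∀
  swap : ∀ m s → suc m * (s * m) ≡ s * (suc m * m)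
  swap = solve-∀
step-integral zero m S s eq with doubling m | doubling-cases m
... | _ | inj₁ (refl , refl) = suc s , cong suc (trans (cong suc (*-identityˡ S)) eq)
... | _ | inj₂ (_ , refl)    = s , trans (expand S) (trans (cong (2 *_) eq) (swap m s))
  where
  expand : ∀ S → suc (1 + 2 * S) ≡ 2 * suc S
  expand = solve-∀
  swap : ∀ m s → 2 * (s * m) ≡ s * (2 * m)
  swap = solve-∀

-- By cofactor*denominator, this says that Σ 1 / denominator w i + 1 / modulus w is an
-- integer.
integral : (w : Word k) → ∃[ s ] suc (sum (cofactor w)) ≡ s * modulus w
integral {zero}  w = 1 , refl
integral {suc k} w =
  let b = w zero
      m = modulus (tail w)
      s , eq   = integral (tail w)
      s′ , eq′ = step-integral b m _ s eq
  in s′ , trans (cong (λ t → suc (newCofactor b m + t))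
                      (sym (*-distribˡ-sum (factor b m) (cofactor (tail w))))) eq′

-- Divisibility and coprimality of moduli and labels.

doubling-nonZero : ∀ m → NonZero (doubling m)
doubling-nonZero 0             = _
doubling-nonZero 1             = _
doubling-nonZero (suc (suc m)) = _

factor-nonZero : ∀ b m → NonZero (factor b m)
factor-nonZero zero    m = doubling-nonZero m
factor-nonZero (suc _) m = _

modulus-nonZero : (w : Word k) → NonZero (modulus w)
modulus-nonZero {zero}  w = _
modulus-nonZero {suc k} w =
  m*n≢0 _ _ {{factor-nonZero (w zero) (modulus (tail w))}} {{modulus-nonZero (tail w)}}

denominator∣modulus : (w : Word k) → ∀ i → denominator w i ∣ modulus w
denominator∣modulus w i = divides (cofactor w i) (sym (cofactor*denominator w i))

coprime-*ʳ : ∀ {m n o} → Coprime m n → Coprime m o → Coprime m (n * o)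
coprime-*ʳ m⊥n m⊥o (d∣m , d∣no) =
  m⊥o (d∣m , coprime-divisor (λ (e∣d , e∣n) → m⊥n (∣-trans e∣d d∣m , e∣n)) d∣no)

coprime-∣ʳ : ∀ {m n o} → o ∣ n → Coprime m n → Coprime m o
coprime-∣ʳ o∣n m⊥n (d∣m , d∣o) = m⊥n (d∣m , ∣-trans d∣o o∣n)

suc-coprime : ∀ m → Coprime (suc m) m
suc-coprime m = subst (λ q → Coprime q m) (+-comm m 1) (coprime-+ (1-coprimeTo m))

-- From 1 a letter leads to 1 or to 2, and an even modulus is only ever multiplied. For an even
-- modulus `m`, `suc m` is coprime to 2, which `letters-distinguished` exploits.
1or2∣modulus : (w : Word k) → modulus w ≡ 1 ⊎ 2 ∣ modulus w
1or2∣modulus {zero}  w = inj₁ refl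
1or2∣modulus {suc k} w = go (w zero) (modulus (tail w)) (1or2∣modulus (tail w))
  where
  go : ∀ b m → m ≡ 1 ⊎ 2 ∣ m → factor b m * m ≡ 1 ⊎ 2 ∣ factor b m * m
  go zero    m (inj₁ refl) = inj₁ refl
  go (suc _) m (inj₁ refl) = inj₂ ∣-refl
  go b       m (inj₂ 2∣m)  = inj₂ (∣n⇒∣m*n (factor b m) 2∣m)

coprime-∣* : ∀ {m n o} → Coprime m n → m ∣ o → n ∣ o → m * n ∣ o
coprime-∣* {m} {n} m⊥n m∣o (divides t refl) =
  *-monoˡ-∣ n (coprime-divisor m⊥n (subst (m ∣_) (*-comm t n) m∣o))

-- With `denominator∣modulus`, this makes the modulus the least common multiple of the labels, hence
-- the exponent of the group. The last label either is the modulus itself or is `suc m`, which is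
-- coprime to the previous modulus `m`.
modulus∣ : (w : Word k) → ∀ {x} → (∀ i → denominator w i ∣ x) → modulus w ∣ x
modulus∣ {zero}  w {x} _   = 1∣ x
modulus∣ {suc k} w {x} d∣x = go (w zero) (d∣x zero)
  where
  m = modulus (tail w)
  go : ∀ b → newDenominator b m ∣ x → factor b m * m ∣ x
  go zero    d∣x₀ = d∣x₀
  go (suc _) d∣x₀ = coprime-∣* (suc-coprime m) d∣x₀ (modulus∣ (tail w) (d∣x ∘ suc))

∏denominator : Word k → ℕ
∏denominator w = ∏ (denominator w)

modulus∣∏denominator : (w : Word k) → modulus w ∣ ∏denominator w
modulus∣∏denominator {zero}  w = ∣-refl
modulus∣∏denominator {suc k} w = go (w zero)
  where
  m = modulus (tail w)
  p = ∏denominator (tail w)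
  go : ∀ b → factor b m * m ∣ newDenominator b m * p
  go zero    = m∣m*n p
  go (suc _) = *-monoʳ-∣ (suc m) (modulus∣∏denominator (tail w))

coprime-∏denominator : (w : Word k) → ∀ {q} → Coprime q (modulus w) → Coprime q (∏denominator w)
coprime-∏denominator {zero}  w q⊥m = q⊥m
coprime-∏denominator {suc k} w {q} q⊥m =
  coprime-*ʳ (go (w zero) q⊥m)
             (coprime-∏denominator (tail w) (coprime-∣ʳ (n∣m*n (factor (w zero) m)) q⊥m))
  where
  m = modulus (tail w)
  go : ∀ b → Coprime q (factor b m * m) → Coprime q (newDenominator b m)
  go zero    = λ q⊥ → q⊥
  go (suc _) = coprime-∣ʳ (m∣m*n m)

newDenominator-nonZero : ∀ b m .{{_ : NonZero m}} → NonZero (newDenominator b m)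
newDenominator-nonZero zero    m = m*n≢0 _ _ {{doubling-nonZero m}}
newDenominator-nonZero (suc _) m = _

denominator-nonZero : (w : Word k) → ∀ i → NonZero (denominator w i)
denominator-nonZero w i = m*n≢0⇒n≢0 (cofactor w i)
  {{subst NonZero (sym (cofactor*denominator w i)) (modulus-nonZero w)}}

-- Recovering a word from its modulus and the product of its labels.

suc-*-injective : ∀ m n → suc m * m ≡ suc n * n → m ≡ n
suc-*-injective m n eq with <-cmp m n
... | tri< m<n _ _ = contradiction eq (<⇒≢ (*-mono-< (s<s m<n) m<n))
... | tri≈ _ m≡n _ = m≡n
... | tri> _ _ n<m = contradiction (sym eq) (<⇒≢ (*-mono-< (s<s n<m) n<m))

2*≢1 : ∀ m → 2 * m ≢ 1
2*≢1 m eq = contradiction (m*n≡1⇒m≡1 2 m eq) λ ()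

doubling-*-injective : ∀ m n → doubling m * m ≡ doubling n * n → m ≡ n
doubling-*-injective m n eq with doubling m | doubling-cases m | doubling n | doubling-cases n
... | _ | inj₁ (refl , refl) | _ | inj₁ (refl , refl) = refl
... | _ | inj₁ (refl , refl) | _ | inj₂ (_ , refl)    = contradiction (sym eq) (2*≢1 n)
... | _ | inj₂ (_ , refl)    | _ | inj₁ (refl , refl) = contradiction eq (2*≢1 m)
... | _ | inj₂ (_ , refl)    | _ | inj₂ (_ , refl)    = *-cancelˡ-≡ m n 2 eq

suc≢1 : ∀ m .{{_ : NonZero m}} → suc m ≢ 1
suc≢1 (suc _) ()

-- For even m, the first equation makes q := m + 1 a divisor of n, hence of r,
-- and then the second one makes q a divisor of p.
letters-distinguished : ∀ {m n p r} .{{_ : NonZero m}} →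
  m ≡ 1 ⊎ 2 ∣ m → Coprime (suc m) p → n ∣ r →
  suc m * m ≡ doubling n * n → suc m * p ≢ (doubling n * n) * r
letters-distinguished {m} {n} {p} {r} parity q⊥p n∣r eq eq′ with doubling n | doubling-cases n
... | _ | inj₁ (refl , refl) = suc≢1 m (m*n≡1⇒m≡1 (suc m) m eq)
... | _ | inj₂ (n≢1 , refl) with parity
...   | inj₁ refl = n≢1 (sym (*-cancelˡ-≡ 1 n 2 eq))
...   | inj₂ 2∣m with q∣n
  where
  q∣n : suc m ∣ n
  q∣n = coprime-divisor (coprime-∣ʳ 2∣m (suc-coprime m))
    (divides m (trans (sym eq) (*-comm (suc m) m)))
...     | divides t refl =
  suc≢1 m (q⊥p (∣-refl , ∣-trans (∣-trans (divides t refl) n∣r) r∣p))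
  where
  r∣p : r ∣ p
  r∣p = divides (2 * t) (*-cancelˡ-≡ p (2 * t * r) (suc m) (trans eq′ (rearrange t (suc m) r)))
    where
    rearrange : ∀ t q r → (2 * (t * q)) * r ≡ q * (2 * t * r)
    rearrange = solve-∀

-- Induction, peeling off the letter used last. Distinct last letters contradict
-- `letters-distinguished`. For equal ones, the update of the modulus is injective, and the common
-- new label then cancels from the products.
word-injective : (v w : Word k) → modulus v ≡ modulus w → ∏denominator v ≡ ∏denominator w →
                 v ≗ w
word-injective {zero}  v w _  _   ()
word-injective {suc k} v w eq eq′ = go (v zero) (w zero) refl refl eq eq′
  where
  m = modulus (tail v)
  n = modulus (tail w)
  p = ∏denominator (tail v)
  r = ∏denominator (tail w)
  instance
    _ = modulus-nonZero (tail v)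
    _ = modulus-nonZero (tail w)

  conclude : v zero ≡ w zero → m ≡ n → p ≡ r → v ≗ w
  conclude v₀≡w₀ m≡n p≡r zero    = v₀≡w₀
  conclude v₀≡w₀ m≡n p≡r (suc i) = word-injective (tail v) (tail w) m≡n p≡r i

  cancel : ∀ b → m ≡ n → newDenominator b m * p ≡ newDenominator b n * r → p ≡ r
  cancel b m≡n eq = *-cancelˡ-≡ p r (newDenominator b m) {{newDenominator-nonZero b m}}
    (trans eq (cong (λ t → newDenominator b t * r) (sym m≡n)))

  go : ∀ b c → v zero ≡ b → w zero ≡ c →
       factor b m * m ≡ factor c n * n → newDenominator b m * p ≡ newDenominator c n * r →
       v ≗ w
  go zero zero v₀ w₀ eq eq′ = conclude (trans v₀ (sym w₀)) m≡n (cancel zero m≡n eq′)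
    where m≡n = doubling-*-injective m n eq
  go (suc zero) (suc zero) v₀ w₀ eq eq′ =
    conclude (trans v₀ (sym w₀)) m≡n (cancel (suc zero) m≡n eq′)
    where m≡n = suc-*-injective m n eq
  go zero (suc zero) v₀ w₀ eq eq′ = contradiction (sym eq′)
    (letters-distinguished (1or2∣modulus (tail w)) (coprime-∏denominator (tail w) (suc-coprime n))
      (modulus∣∏denominator (tail v)) (sym eq))
  go (suc zero) zero v₀ w₀ eq eq′ = contradiction eq′
    (letters-distinguished (1or2∣modulus (tail v)) (coprime-∏denominator (tail v) (suc-coprime m))
      (modulus∣∏denominator (tail w)) eq)

-- Diagonal matrices and products of cyclic groups.

apply-diag : (d x : Fin k → ℤ) → ∀ i → apply (diag d) x i ≡ d i ℤ.* x i
apply-diag {suc k} d x zero = trans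
  (cong (λ t → d zero ℤ.* x zero ℤ.+ t)
    (trans (∑.sum-cong-≗ (λ j → ℤ.*-zeroˡ (x (suc j)))) (∑.sum-replicate-zero k)))
  (ℤ.+-identityʳ _)
apply-diag d x (suc i) = trans
  (cong₂ ℤ._+_ (ℤ.*-zeroˡ (x zero)) (apply-diag (tail d) (tail x) i))
  (ℤ.+-identityˡ _)

apply--ᴹ : (M N : Matrix k l) (x : Fin l → ℤ) → ∀ i →
           apply (M -ᴹ N) x i ≡ apply M x i ℤ.- apply N x i
apply--ᴹ {l = zero}  M N x i = refl
apply--ᴹ {l = suc l} M N x i = trans
  (cong (λ t → (M i zero ℤ.- N i zero) ℤ.* x zero ℤ.+ t)
    (apply--ᴹ (tail ∘ M) (tail ∘ N) (tail x) i))
  (rearrange (M i zero) (N i zero) (x zero) _ _)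
  where
  rearrange : ∀ a b x y z → (a ℤ.- b) ℤ.* x ℤ.+ (y ℤ.- z) ≡ (a ℤ.* x ℤ.+ y) ℤ.- (b ℤ.* x ℤ.+ z)
  rearrange = ℤSolver.solve-∀

-- The product of the groups ℤ/dᵢ: two vectors are equal here when they are congruent modulo `d i`
-- in every coordinate.
cyclicProduct : (Fin k → ℕ) → AbelianGroup 0ℓ 0ℓ
cyclicProduct d = matrixCokernel (diag (λ i → + d i))

module _ (d : Fin k → ℕ) where
  open AbelianGroup (cyclicProduct d) using (_≈_)

  ≈⇒∣ : ∀ x y → x ≈ y → ∀ i → + d i ℤ.∣ x i ℤ.- y i
  ≈⇒∣ x y (z , eq) i = ℤ.divides (z i)
    (trans (sym (eq i)) (trans (apply-diag (λ i → + d i) z i) (ℤ.*-comm (+ d i) (z i))))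

  ∣⇒≈ : ∀ x y → (∀ i → + d i ℤ.∣ x i ℤ.- y i) → x ≈ y
  ∣⇒≈ x y d∣ = q , λ i →
    trans (apply-diag (λ i → + d i) q i)
      (trans (ℤ.*-comm (+ d i) (q i)) (sym (ℤ._∣_.equality (d∣ i))))
    where q = λ i → ℤ.quotient (d∣ i)

  ≗⇒≈ : ∀ x y → x ≗ y → x ≈ y
  ≗⇒≈ x y x≗y = ∣⇒≈ x y λ i → ℤ.divides ℤ.0ℤ (ℤ.i≡j⇒i-j≡0 (x≗y i))

%ℕ≡⇒∣- : ∀ d x y .{{_ : NonZero d}} → x %ℕ d ≡ y %ℕ d → + d ℤ.∣ x ℤ.- y
%ℕ≡⇒∣- d x y eq = ℤ.divides (x /ℕ d ℤ.- y /ℕ d) (begin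
  x ℤ.- y
    ≡⟨ cong₂ ℤ._-_ (a≡a%ℕn+[a/ℕn]*n x d) (a≡a%ℕn+[a/ℕn]*n y d) ⟩
  (+ (x %ℕ d) ℤ.+ x /ℕ d ℤ.* + d) ℤ.- (+ (y %ℕ d) ℤ.+ y /ℕ d ℤ.* + d)
    ≡⟨ cong (λ r → (+ r ℤ.+ x /ℕ d ℤ.* + d) ℤ.- (+ (y %ℕ d) ℤ.+ y /ℕ d ℤ.* + d)) eq ⟩
  (+ (y %ℕ d) ℤ.+ x /ℕ d ℤ.* + d) ℤ.- (+ (y %ℕ d) ℤ.+ y /ℕ d ℤ.* + d)
    ≡⟨ rearrange (+ (y %ℕ d)) (x /ℕ d) (y /ℕ d) (+ d) ⟩
  (x /ℕ d ℤ.- y /ℕ d) ℤ.* + d ∎)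
  where
  open ≡-Reasoning
  rearrange : ∀ r p q d → (r ℤ.+ p ℤ.* d) ℤ.- (r ℤ.+ q ℤ.* d) ≡ (p ℤ.- q) ℤ.* d
  rearrange = ℤSolver.solve-∀

∣∧<⇒≡0 : ∀ {m n} → m ∣ n → n < m → n ≡ 0
∣∧<⇒≡0 {n = zero}  _   _   = refl
∣∧<⇒≡0 {n = suc _} m∣n n<m = contradiction m∣n (>⇒∤ n<m)

-- The difference has absolute value at most `m ⊔ n`, which is below `d`, and the only such multiple
-- of `d` is zero.
∣-⇒≡ : ∀ {d m n} → m < d → n < d → + d ℤ.∣ + m ℤ.- + n → m ≡ n
∣-⇒≡ {d} {m} {n} m<d n<d d∣m-n = ℤ.+-injective (ℤ.i-j≡0⇒i≡j (+ m) (+ n)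
  (ℤ.∣i∣≡0⇒i≡0 (∣∧<⇒≡0 (ℤ.∣⇒∣ᵤ d∣m-n) small)))
  where
  small : ℤ.∣ + m ℤ.- + n ∣ < d
  small = ≤-<-trans
    (subst (λ i → ℤ.∣ i ∣ ≤ m ⊔ n) (sym (ℤ.m-n≡m⊖n m n)) (ℤ.∣m⊝n∣≤m⊔n m n))
    (⊔-lub m<d n<d)

-- The mixed-radix number whose digits are the remainders of the coordinates. `decode` reads the
-- digits back as a vector of least nonnegative representatives.
encode : (d : Fin k → ℕ) → (∀ i → NonZero (d i)) → (Fin k → ℤ) → Fin (∏ d)
encode {zero}  d d≢0 x = zero
encode {suc k} d d≢0 x = combine
  (fromℕ< (n%ℕd<d (x zero) (d zero) {{d≢0 zero}})) (encode (tail d) (d≢0 ∘ suc) (tail x))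

decode : (d : Fin k → ℕ) → Fin (∏ d) → Fin k → ℤ
decode {suc k} d a zero    = + toℕ (proj₁ (remQuot {d zero} (∏ (tail d)) a))
decode {suc k} d a (suc i) = decode (tail d) (proj₂ (remQuot {d zero} (∏ (tail d)) a)) i

encode-reflects : (d : Fin k → ℕ) (d≢0 : ∀ i → NonZero (d i)) → ∀ x y →
                  encode d d≢0 x ≡ encode d d≢0 y → ∀ i → + d i ℤ.∣ x i ℤ.- y i
encode-reflects {suc k} d d≢0 x y eq = λ where
    zero    → %ℕ≡⇒∣- (d zero) (x zero) (y zero) {{d≢0 zero}}
      (trans (sym (toℕ-fromℕ< (bound x))) (trans (cong toℕ (proj₁ eqs)) (toℕ-fromℕ< (bound y))))
    (suc i) → encode-reflects (tail d) (d≢0 ∘ suc) (tail x) (tail y) (proj₂ eqs) i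
  where
  bound = λ (x : Fin (suc k) → ℤ) → n%ℕd<d (x zero) (d zero) {{d≢0 zero}}
  code = encode (tail d) (d≢0 ∘ suc) ∘ tail
  eqs = combine-injective (fromℕ< (bound x)) (code x) (fromℕ< (bound y)) (code y) eq

decode-injective : (d : Fin k → ℕ) → ∀ {a b} →
                   (∀ i → + d i ℤ.∣ decode d a i ℤ.- decode d b i) → a ≡ b
decode-injective {zero}  d {zero} {zero} _  = refl
decode-injective {suc k} d {a} {b} d∣ = begin
  a                     ≡⟨ combine-remQuot {d zero} (∏ (tail d)) a ⟨
  uncurry combine a′    ≡⟨ cong₂ combine
    (toℕ-injective (∣-⇒≡ (toℕ<n (proj₁ a′)) (toℕ<n (proj₁ b′)) (d∣ zero)))
    (decode-injective (tail d) (d∣ ∘ suc)) ⟩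
  uncurry combine b′    ≡⟨ combine-remQuot {d zero} (∏ (tail d)) b ⟩
  b                     ∎
  where
  open ≡-Reasoning
  a′ = remQuot {d zero} (∏ (tail d)) a
  b′ = remQuot {d zero} (∏ (tail d)) b

-- Order and exponent under isomorphism.

module _ {a b ℓ₁ ℓ₂} (A : AbelianGroup a ℓ₁) (B : AbelianGroup b ℓ₂) where

  private
    module A = AbelianGroup A
    module B = AbelianGroup B
    open Mult A.commutativeMonoid using () renaming (_×_ to _×ᴬ_)
    open Mult B.commutativeMonoid using () renaming (_×_ to _×ᴮ_)

  ×-homo : ∀ {f} → GroupMorphisms.IsGroupHomomorphism A.rawGroup B.rawGroup f →
           ∀ n x → f (n ×ᴬ x) B.≈ n ×ᴮ f x
  ×-homo f-homo zero    x = GroupMorphisms.IsGroupHomomorphism.ε-homo f-homo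
  ×-homo f-homo (suc n) x = B.trans
    (GroupMorphisms.IsGroupHomomorphism.homo f-homo _ _) (B.∙-congˡ (×-homo f-homo n x))

module _ (M : Matrix k l) where

  open Mult (AbelianGroup.commutativeMonoid (matrixCokernel M)) using ()
    renaming (_×_ to _·_)

  ·-pointwise : ∀ n x i → (n · x) i ≡ + n ℤ.* x i
  ·-pointwise zero    x i = sym (ℤ.*-zeroˡ (x i))
  ·-pointwise (suc n) x i = trans
    (cong (λ t → x i ℤ.+ t) (·-pointwise n x i)) (sym (ℤ.suc-* (+ n) (x i)))

module _ (d : Fin k → ℕ) (e : Fin l → ℕ) (iso : cyclicProduct d ≅ cyclicProduct e) where

  private
    module D = AbelianGroup (cyclicProduct d)
    module E = AbelianGroup (cyclicProduct e)
    f = proj₁ iso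
    open Mult D.commutativeMonoid using () renaming (_×_ to _·ᴰ_)
    open Mult E.commutativeMonoid using () renaming (_×_ to _·ᴱ_)
    open GroupMorphisms.IsGroupIsomorphism (proj₂ iso)

  -- Decoding, applying the isomorphism and encoding is an injection between finite sets of these
  -- sizes.
  order-≤ : (∀ i → NonZero (e i)) → ∏ d ≤ ∏ e
  order-≤ e≢0 = injective⇒≤ {f = encode e e≢0 ∘ f ∘ decode d} λ {a} {b} eq →
    let x = decode d a; y = decode d b in
    decode-injective d (≈⇒∣ d x y (injective {x} {y}
      (∣⇒≈ e (f x) (f y) (encode-reflects e e≢0 (f x) (f y) eq))))

  -- Since `m` annihilates the target, injectivity makes it annihilate the all-ones vector of the
  -- source, whose multiple by `m` has every coordinate equal to `m`.
  exponent-∣ : ∀ {m} → (∀ j → e j ∣ m) → ∀ i → d i ∣ m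
  exponent-∣ {m} e∣m i = subst (d i ∣_) (cong ℤ.∣_∣ m·1≡m)
    (ℤ.∣⇒∣ᵤ (≈⇒∣ d (m ·ᴰ one) D.ε (injective {m ·ᴰ one} {D.ε} f[m·1]≈f[ε]) i))
    where
    one = λ _ → ℤ.1ℤ
    m·1≡m : (m ·ᴰ one) i ℤ.- ℤ.0ℤ ≡ + m
    m·1≡m = trans (ℤ.+-identityʳ _)
      (trans (·-pointwise (diag (λ i → + d i)) m one i) (ℤ.*-identityʳ (+ m)))
    m·f1≈ε : m ·ᴱ f one E.≈ E.ε
    m·f1≈ε = ∣⇒≈ e (m ·ᴱ f one) E.ε λ j → subst (+ e j ℤ.∣_)
      (sym (trans (ℤ.+-identityʳ _) (·-pointwise (diag (λ i → + e i)) m (f one) j)))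
      (ℤ.∣m⇒∣m*n {m = + m} (f one j) (ℤ.∣ᵤ⇒∣ (e∣m j)))
    f[m·1]≈f[ε] : f (m ·ᴰ one) E.≈ f D.ε
    f[m·1]≈f[ε] = E.trans {f (m ·ᴰ one)} {m ·ᴱ f one} {f D.ε}
      (×-homo (cyclicProduct d) (cyclicProduct e) isGroupHomomorphism m one)
      (E.trans {m ·ᴱ f one} {E.ε} {f D.ε} m·f1≈ε (E.sym {f D.ε} {E.ε} ε-homo))

-- The critical group of a labelled star.

∑+*-const : (c : Fin k → ℕ) (t : ℤ) → ∑.sum (λ i → + c i ℤ.* t) ≡ + sum c ℤ.* t
∑+*-const {zero}  c t = sym (ℤ.*-zeroˡ t)
∑+*-const {suc k} c t = trans
  (cong (λ u → + c zero ℤ.* t ℤ.+ u) (∑+*-const (tail c) t))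
  (sym (ℤ.*-distribʳ-+ t (+ c zero) (+ sum (tail c))))

module _ (z : Fin (suc k) → ℤ) where

  open Graph (starGraph k) using (adjacencyMatrix)

  apply-adj-centre : apply adjacencyMatrix z zero ≡ ∑.sum (tail z)
  apply-adj-centre = trans
    (cong₂ ℤ._+_ (ℤ.*-zeroˡ (z zero)) (∑.sum-cong-≗ (λ j → ℤ.*-identityˡ (z (suc j)))))
    (ℤ.+-identityˡ _)

  apply-adj-leaf : ∀ j → apply adjacencyMatrix z (suc j) ≡ z zero
  apply-adj-leaf j = trans
    (cong₂ ℤ._+_ (ℤ.*-identityˡ (z zero))
      (trans (∑.sum-cong-≗ (λ j → ℤ.*-zeroˡ (z (suc j)))) (∑.sum-replicate-zero k)))
    (ℤ.+-identityʳ _)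

-- The first two leaves carry the label L, the others the labels d i.
module _ (d c : Fin k → ℕ) (L s : ℕ) .{{L≢0 : NonZero L}}
         (c*d≡L : ∀ i → c i * d i ≡ L)
         (2+∑c≡s*L : 2 + sum c ≡ s * L) where

  starStructure : ArithmeticalStructure (starGraph (2 + k))
  starStructure = record
    { d          = s ∷ L ∷ L ∷ d
    ; r          = r
    ; r-positive = positive
    ; r-coprime  = λ m m∣r → ∣1⇒≡1 (m∣r (suc zero))
    ; balanced   = balanced
    }
    where
    -- At a leaf, label times `r` must equal the value at the centre. Taking `L` there gives 1 at
    -- the two leaves labelled `L` and `c i` at the others.
    r : Fin (3 + k) → ℕ
    r = L ∷ 1 ∷ 1 ∷ c

    positive : ∀ v → NonZero (r v)
    -- `NonZero L` is given only as an irrelevant instance; the detour through `0 < L` yields a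
    -- relevant proof.
    positive zero                = >-nonZero (>-nonZero⁻¹ L)
    positive (suc zero)          = _
    positive (suc (suc zero))    = _
    positive (suc (suc (suc i))) = m*n≢0⇒m≢0 (c i)
      {{subst NonZero (sym (c*d≡L i)) (>-nonZero (>-nonZero⁻¹ L))}}

    centre : sum (λ j → 1 * r (suc j)) ≡ 2 + sum c
    centre = sum-cong-≗ (λ j → *-identityˡ (r (suc j)))

    leaf : 1 * L + sum (λ j → 0 * r (suc j)) ≡ L
    leaf = trans (cong₂ _+_ (*-identityˡ L) (sum-replicate-zero (2 + k))) (+-identityʳ L)

    open Graph (starGraph (2 + k)) using (adj)

    balanced : ∀ v → r v * (s ∷ L ∷ L ∷ d) v ≡ sum (λ u → adj v u * r u)
    balanced zero                = trans (*-comm L s) (sym (trans centre 2+∑c≡s*L))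
    balanced (suc zero)          = trans (*-identityˡ L) (sym leaf)
    balanced (suc (suc zero))    = trans (*-identityˡ L) (sym leaf)
    balanced (suc (suc (suc i))) = trans (c*d≡L i) (sym leaf)

  open ArithmeticalStructure starStructure using (r) renaming (d to label)

  open Graph (starGraph (2 + k)) using (adjacencyMatrix)

  laplacian : Matrix (3 + k) (3 + k)
  laplacian = diag (λ v → + label v) -ᴹ adjacencyMatrix

  apply-laplacian-centre : ∀ z → apply laplacian z zero ≡ + s ℤ.* z zero ℤ.- ∑.sum (tail z)
  apply-laplacian-centre z = trans (apply--ᴹ (diag (λ v → + label v)) adjacencyMatrix z zero)
    (cong₂ ℤ._-_ (apply-diag (λ v → + label v) z zero) (apply-adj-centre z))

  apply-laplacian-leaf : ∀ z j → apply laplacian z (suc j) ≡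
                                 + label (suc j) ℤ.* z (suc j) ℤ.- z zero
  apply-laplacian-leaf z j = trans (apply--ᴹ (diag (λ v → + label v)) adjacencyMatrix z (suc j))
    (cong₂ ℤ._-_ (apply-diag (λ v → + label v) z (suc j)) (apply-adj-leaf z j))

  -- The vector `r` as a one-row matrix, so that `linearMap` supplies the homomorphism laws of `ψ`.
  weighted : Matrix 1 (3 + k)
  weighted _ v = + r v

  private
    module ψ = GroupHomomorphism (linearMap weighted)

  -- The vector r spans the kernel of the symmetric Laplacian, so ψ vanishes exactly on the
  -- vectors representing torsion elements.
  ψ : (Fin (3 + k) → ℤ) → ℤ
  ψ x = apply weighted x zero

  φ : (Fin (3 + k) → ℤ) → Fin k → ℤ
  φ x i = x (suc (suc (suc i))) ℤ.- x (suc (suc zero))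

  private
    2+∑c≡s*Lᶻ : + 2 ℤ.+ + sum c ≡ + s ℤ.* + L
    2+∑c≡s*Lᶻ = trans (cong +_ 2+∑c≡s*L) (ℤ.pos-* s L)

    c*d≡Lᶻ : ∀ i → + c i ℤ.* + d i ≡ + L
    c*d≡Lᶻ i = trans (sym (ℤ.pos-* (c i) (d i))) (cong +_ (c*d≡L i))

    ∑c*d* : (q : Fin k → ℤ) → ∑.sum (λ i → + c i ℤ.* (+ d i ℤ.* q i)) ≡ + L ℤ.* ∑.sum q
    ∑c*d* q = trans
      (∑.sum-cong-≗ (λ i →
        trans (sym (ℤ.*-assoc (+ c i) (+ d i) (q i))) (cong (ℤ._* q i) (c*d≡Lᶻ i))))
      (sym (∑.*-distribˡ-sum (+ L) q))

    ∑c*- : (f : Fin k → ℤ) (t : ℤ) →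
           ∑.sum (λ i → + c i ℤ.* (f i ℤ.- t)) ≡
           ∑.sum (λ i → + c i ℤ.* f i) ℤ.- + sum c ℤ.* t
    ∑c*- f t = begin
      ∑.sum (λ i → + c i ℤ.* (f i ℤ.- t))
        ≡⟨ ∑.sum-cong-≗ (λ i → ℤ.*-distribˡ-+ (+ c i) (f i) (ℤ.- t)) ⟩
      ∑.sum (λ i → + c i ℤ.* f i ℤ.+ + c i ℤ.* ℤ.- t)
        ≡⟨ ∑.∑-distrib-+ (λ i → + c i ℤ.* f i) (λ i → + c i ℤ.* ℤ.- t) ⟩
      ∑.sum (λ i → + c i ℤ.* f i) ℤ.+ ∑.sum (λ i → + c i ℤ.* ℤ.- t)
        ≡⟨ cong (λ u → ∑.sum (λ i → + c i ℤ.* f i) ℤ.+ u) (∑+*-const c (ℤ.- t)) ⟩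
      ∑.sum (λ i → + c i ℤ.* f i) ℤ.+ + sum c ℤ.* ℤ.- t
        ≡⟨ cong (λ u → ∑.sum (λ i → + c i ℤ.* f i) ℤ.+ u) (sym (ℤ.neg-distribʳ-* (+ sum c) t)) ⟩
      ∑.sum (λ i → + c i ℤ.* f i) ℤ.- + sum c ℤ.* t ∎
      where open ≡-Reasoning

  -- The centre contributes the same term to both leaf rows, so it cancels in the difference. What
  -- remains is a multiple of `d i`, because `d i` divides `L`.
  image⇒φ∣ : ∀ z x → apply laplacian z ≗ x → ∀ i → + d i ℤ.∣ φ x i
  image⇒φ∣ z x eq i = ℤ.divides (z vᵢ ℤ.- + c i ℤ.* z v₂) (begin
    x vᵢ ℤ.- x v₂
      ≡⟨ cong₂ ℤ._-_ (eq vᵢ) (eq v₂) ⟨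
    apply laplacian z vᵢ ℤ.- apply laplacian z v₂
      ≡⟨ cong₂ ℤ._-_ (apply-laplacian-leaf z (suc (suc i))) (apply-laplacian-leaf z (suc zero)) ⟩
    (+ d i ℤ.* z vᵢ ℤ.- z zero) ℤ.- (+ L ℤ.* z v₂ ℤ.- z zero)
      ≡⟨ cong (λ t → (+ d i ℤ.* z vᵢ ℤ.- z zero) ℤ.- (t ℤ.* z v₂ ℤ.- z zero)) (c*d≡Lᶻ i) ⟨
    (+ d i ℤ.* z vᵢ ℤ.- z zero) ℤ.- (+ c i ℤ.* + d i ℤ.* z v₂ ℤ.- z zero)
      ≡⟨ rearrange (+ d i) (+ c i) (z zero) (z v₂) (z vᵢ) ⟩
    (z vᵢ ℤ.- + c i ℤ.* z v₂) ℤ.* + d i ∎)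
    where
    open ≡-Reasoning
    v₂ = suc (suc zero)
    vᵢ = suc (suc (suc i))
    rearrange : ∀ d c z₀ z₂ zᵢ →
      (d ℤ.* zᵢ ℤ.- z₀) ℤ.- (c ℤ.* d ℤ.* z₂ ℤ.- z₀) ≡ (zᵢ ℤ.- c ℤ.* z₂) ℤ.* d
    rearrange = ℤSolver.solve-∀

  -- The leaf coordinates of `z` cancel because `r` times the label is `L` at every leaf; the centre
  -- coordinate is left with the coefficient `s * L - (2 + sum c)`, which is zero.
  image⇒ψ≡0 : ∀ z x → apply laplacian z ≗ x → ψ x ≡ ℤ.0ℤ
  image⇒ψ≡0 z x eq = begin
    ψ x
      ≡⟨ ψ.⟦⟧-cong (sym ∘ eq) zero ⟩
    ψ (apply laplacian z)
      ≡⟨ cong₂ ℤ._+_ (cong (+ L ℤ.*_) (apply-laplacian-centre z))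
          (∑.sum-cong-≗ (λ j → cong (+ r (suc j) ℤ.*_) (apply-laplacian-leaf z j))) ⟩
    + L ℤ.* (+ s ℤ.* z₀ ℤ.- (z₁ ℤ.+ (z₂ ℤ.+ Z))) ℤ.+
      (ℤ.1ℤ ℤ.* (+ L ℤ.* z₁ ℤ.- z₀) ℤ.+ (ℤ.1ℤ ℤ.* (+ L ℤ.* z₂ ℤ.- z₀) ℤ.+
        ∑.sum (λ i → + c i ℤ.* (+ d i ℤ.* z′ i ℤ.- z₀))))
      ≡⟨ cong (λ t → + L ℤ.* (+ s ℤ.* z₀ ℤ.- (z₁ ℤ.+ (z₂ ℤ.+ Z))) ℤ.+
           (ℤ.1ℤ ℤ.* (+ L ℤ.* z₁ ℤ.- z₀) ℤ.+ (ℤ.1ℤ ℤ.* (+ L ℤ.* z₂ ℤ.- z₀) ℤ.+ t)))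
           (trans (∑c*- _ z₀) (cong (ℤ._- C ℤ.* z₀) (∑c*d* z′))) ⟩
    + L ℤ.* (+ s ℤ.* z₀ ℤ.- (z₁ ℤ.+ (z₂ ℤ.+ Z))) ℤ.+
      (ℤ.1ℤ ℤ.* (+ L ℤ.* z₁ ℤ.- z₀) ℤ.+ (ℤ.1ℤ ℤ.* (+ L ℤ.* z₂ ℤ.- z₀) ℤ.+
        (+ L ℤ.* Z ℤ.- C ℤ.* z₀)))
      ≡⟨ rearrange (+ L) (+ s) C z₀ z₁ z₂ Z ⟩
    (+ s ℤ.* + L ℤ.- (+ 2 ℤ.+ C)) ℤ.* z₀
      ≡⟨ cong (λ t → (+ s ℤ.* + L ℤ.- t) ℤ.* z₀) 2+∑c≡s*Lᶻ ⟩
    (+ s ℤ.* + L ℤ.- + s ℤ.* + L) ℤ.* z₀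
      ≡⟨ cong (ℤ._* z₀) (ℤ.+-inverseʳ (+ s ℤ.* + L)) ⟩
    ℤ.0ℤ ℤ.* z₀
      ≡⟨ ℤ.*-zeroˡ z₀ ⟩
    ℤ.0ℤ ∎
    where
    open ≡-Reasoning
    z₀ = z zero
    z₁ = z (suc zero)
    z₂ = z (suc (suc zero))
    z′ = tail (tail (tail z))
    Z  = ∑.sum z′
    C  = + sum c
    rearrange : ∀ L s C z₀ z₁ z₂ Z →
      L ℤ.* (s ℤ.* z₀ ℤ.- (z₁ ℤ.+ (z₂ ℤ.+ Z))) ℤ.+
        (ℤ.1ℤ ℤ.* (L ℤ.* z₁ ℤ.- z₀) ℤ.+ (ℤ.1ℤ ℤ.* (L ℤ.* z₂ ℤ.- z₀) ℤ.+
          (L ℤ.* Z ℤ.- C ℤ.* z₀)))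
      ≡ (s ℤ.* L ℤ.- (+ 2 ℤ.+ C)) ℤ.* z₀
    rearrange = ℤSolver.solve-∀

  -- Once `z` is zero at the second leaf, that row fixes the centre, the rows labelled `d i` fix the
  -- quotients `q`, and the centre row fixes the first leaf. The row of the first leaf then holds
  -- because `ψ x` vanishes.
  ψ≡0∧φ∣⇒image : ∀ x → ψ x ≡ ℤ.0ℤ → (∀ i → + d i ℤ.∣ φ x i) → ∃[ z ] apply laplacian z ≗ x
  ψ≡0∧φ∣⇒image x ψx≡0 d∣φx = z , λ where
      zero                → trans (apply-laplacian-centre z) (centre (+ s) x₀ x₂ Q)
      (suc zero)          → trans (apply-laplacian-leaf z zero) leaf₁
      (suc (suc zero))    → trans (apply-laplacian-leaf z (suc zero)) (leaf₂ (+ L) x₂)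
      (suc (suc (suc i))) → trans (apply-laplacian-leaf z (suc (suc i)))
        (trans (cong (ℤ._- ℤ.- x₂) (d*q i)) (leafᵢ (x′ i) x₂))
    where
    open ≡-Reasoning
    x₀ = x zero
    x₁ = x (suc zero)
    x₂ = x (suc (suc zero))
    x′ = tail (tail (tail x))
    q  = λ i → ℤ.quotient (d∣φx i)
    Q  = ∑.sum q
    C  = + sum c
    S  = ∑.sum (λ i → + c i ℤ.* x′ i)

    -- Since z is only determined up to multiples of r, it may be chosen to vanish at the
    -- second leaf.
    z : Fin (3 + k) → ℤ
    z = ℤ.- x₂ ∷ + s ℤ.* ℤ.- x₂ ℤ.- Q ℤ.- x₀ ∷ ℤ.0ℤ ∷ q

    d*q : ∀ i → + d i ℤ.* q i ≡ x′ i ℤ.- x₂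
    d*q i = trans (ℤ.*-comm (+ d i) (q i)) (sym (ℤ._∣_.equality (d∣φx i)))

    L*Q : + L ℤ.* Q ≡ S ℤ.- C ℤ.* x₂
    L*Q = trans (sym (∑c*d* q))
      (trans (∑.sum-cong-≗ (λ i → cong (+ c i ℤ.*_) (d*q i))) (∑c*- x′ x₂))

    centre : ∀ s x₀ x₂ Q →
      s ℤ.* ℤ.- x₂ ℤ.- (s ℤ.* ℤ.- x₂ ℤ.- Q ℤ.- x₀ ℤ.+ (ℤ.0ℤ ℤ.+ Q)) ≡ x₀
    centre = ℤSolver.solve-∀

    leaf₂ : ∀ L x₂ → L ℤ.* ℤ.0ℤ ℤ.- ℤ.- x₂ ≡ x₂
    leaf₂ = ℤSolver.solve-∀

    leafᵢ : ∀ xᵢ x₂ → xᵢ ℤ.- x₂ ℤ.- ℤ.- x₂ ≡ xᵢ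
    leafᵢ = ℤSolver.solve-∀

    expand : ∀ L s x₀ x₂ Q →
      L ℤ.* (s ℤ.* ℤ.- x₂ ℤ.- Q ℤ.- x₀) ℤ.- ℤ.- x₂ ≡
      x₂ ℤ.- s ℤ.* L ℤ.* x₂ ℤ.- L ℤ.* Q ℤ.- L ℤ.* x₀
    expand = ℤSolver.solve-∀

    collect : ∀ L C S x₀ x₁ x₂ →
      x₂ ℤ.- (+ 2 ℤ.+ C) ℤ.* x₂ ℤ.- (S ℤ.- C ℤ.* x₂) ℤ.- L ℤ.* x₀ ≡
      x₁ ℤ.- (L ℤ.* x₀ ℤ.+ (ℤ.1ℤ ℤ.* x₁ ℤ.+ (ℤ.1ℤ ℤ.* x₂ ℤ.+ S)))
    collect = ℤSolver.solve-∀

    leaf₁ : + L ℤ.* z (suc zero) ℤ.- z zero ≡ x₁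
    leaf₁ = begin
      + L ℤ.* (+ s ℤ.* ℤ.- x₂ ℤ.- Q ℤ.- x₀) ℤ.- ℤ.- x₂
        ≡⟨ expand (+ L) (+ s) x₀ x₂ Q ⟩
      x₂ ℤ.- + s ℤ.* + L ℤ.* x₂ ℤ.- + L ℤ.* Q ℤ.- + L ℤ.* x₀
        ≡⟨ cong₂ (λ t u → x₂ ℤ.- t ℤ.* x₂ ℤ.- u ℤ.- + L ℤ.* x₀) (sym 2+∑c≡s*Lᶻ) L*Q ⟩
      x₂ ℤ.- (+ 2 ℤ.+ C) ℤ.* x₂ ℤ.- (S ℤ.- C ℤ.* x₂) ℤ.- + L ℤ.* x₀
        ≡⟨ collect (+ L) C S x₀ x₁ x₂ ⟩
      x₁ ℤ.- ψ x
        ≡⟨ cong (λ t → x₁ ℤ.- t) ψx≡0 ⟩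
      x₁ ℤ.- ℤ.0ℤ
        ≡⟨ ℤ.+-identityʳ x₁ ⟩
      x₁ ∎

  private
    module K = AbelianGroup (criticalGroup (starGraph (2 + k)) starStructure)
    module H = AbelianGroup (cyclicProduct d)
    open Mult (AbelianGroup.commutativeMonoid (matrixCokernel laplacian)) using ()
      renaming (_×_ to _·_)

  ψ-- : ∀ x y → ψ (λ v → x v ℤ.- y v) ≡ ψ x ℤ.- ψ y
  ψ-- x y = trans (ψ.homo x (λ v → ℤ.- y v) zero) (cong (λ t → ψ x ℤ.+ t) (ψ.⁻¹-homo y zero))

  -- The subtracted zero is the form in which `m · x ≈ ε` unfolds in the cokernel.
  ψ-· : ∀ m x → ψ (λ v → (m · x) v ℤ.- ℤ.0ℤ) ≡ + m ℤ.* ψ x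
  ψ-· m x = begin
    ψ (λ v → (m · x) v ℤ.- ℤ.0ℤ)
      ≡⟨ ψ.⟦⟧-cong (λ v → trans (ℤ.+-identityʳ ((m · x) v)) (·-pointwise laplacian m x v)) zero ⟩
    ∑.sum (λ v → + r v ℤ.* (+ m ℤ.* x v))
      ≡⟨ ∑.sum-cong-≗ (λ v → swap (+ r v) (+ m) (x v)) ⟩
    ∑.sum (λ v → + m ℤ.* (+ r v ℤ.* x v))
      ≡⟨ ∑.*-distribˡ-sum (+ m) (λ v → + r v ℤ.* x v) ⟨
    + m ℤ.* ψ x ∎
    where
    open ≡-Reasoning
    swap : ∀ a b x → a ℤ.* (b ℤ.* x) ≡ b ℤ.* (a ℤ.* x)
    swap = ℤSolver.solve-∀

  -- Some nonzero multiple of `x` lies in the image, where `ψ` vanishes, and ℤ has no torsion.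
  torsion⇒ψ≡0 : ∀ x → IsTorsion (matrixCokernel laplacian) x → ψ x ≡ ℤ.0ℤ
  torsion⇒ψ≡0 x (m , m≢0 , z , eq) = ℤ.*-cancelˡ-≡ (+ m) (ψ x) ℤ.0ℤ {{m≢0}} (begin
    + m ℤ.* ψ x                     ≡⟨ ψ-· m x ⟨
    ψ (λ v → (m · x) v ℤ.- ℤ.0ℤ)    ≡⟨ image⇒ψ≡0 z _ eq ⟩
    ℤ.0ℤ                            ≡⟨ ℤ.*-zeroʳ (+ m) ⟨
    + m ℤ.* ℤ.0ℤ                    ∎)
    where open ≡-Reasoning

  -- A section of `φ`. The first leaf has weight 1 in `ψ` and does not enter `φ`, so its coordinate
  -- can be chosen to make `ψ` vanish.
  lift : (Fin k → ℤ) → Fin (3 + k) → ℤ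
  lift h = ℤ.0ℤ ∷ ℤ.- ∑.sum (λ i → + c i ℤ.* h i) ∷ ℤ.0ℤ ∷ h

  ψ-lift : ∀ h → ψ (lift h) ≡ ℤ.0ℤ
  ψ-lift h = cancel (+ L) (∑.sum (λ i → + c i ℤ.* h i))
    where
    cancel : ∀ L S → L ℤ.* ℤ.0ℤ ℤ.+ (ℤ.1ℤ ℤ.* ℤ.- S ℤ.+ (ℤ.1ℤ ℤ.* ℤ.0ℤ ℤ.+ S)) ≡ ℤ.0ℤ
    cancel = ℤSolver.solve-∀

  -- Multiplication by `L` kills the class: every `d i` divides `L`, and `ψ` is already zero.
  lift-torsion : ∀ h → IsTorsion (matrixCokernel laplacian) (lift h)
  lift-torsion h = L , >-nonZero (>-nonZero⁻¹ L) ,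
    ψ≡0∧φ∣⇒image (λ v → (L · lift h) v ℤ.- ℤ.0ℤ)
      (trans (ψ-· L (lift h)) (trans (cong (+ L ℤ.*_) (ψ-lift h)) (ℤ.*-zeroʳ (+ L))))
      λ i → ℤ.∣m∣n⇒∣m-n (d∣L· i (suc (suc (suc i)))) (d∣L· i (suc (suc zero)))
    where
    d∣L· : ∀ i v → + d i ℤ.∣ (L · lift h) v ℤ.- ℤ.0ℤ
    d∣L· i v = subst (+ d i ℤ.∣_)
      (sym (trans (ℤ.+-identityʳ _) (·-pointwise laplacian L (lift h) v)))
      (ℤ.∣m⇒∣m*n {m = + L} (lift h v) (ℤ.∣ᵤ⇒∣ (divides (c i) (sym (c*d≡L i)))))

  φ-- : ∀ x y i → φ (λ v → x v ℤ.- y v) i ≡ φ x i ℤ.- φ y i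
  φ-- x y i = rearrange (x _) (x _) (y _) (y _)
    where
    rearrange : ∀ a b c d → (a ℤ.- c) ℤ.- (b ℤ.- d) ≡ (a ℤ.- b) ℤ.- (c ℤ.- d)
    rearrange = ℤSolver.solve-∀

  -- Well-definedness is `image⇒φ∣`. Injectivity is `ψ≡0∧φ∣⇒image`, as `ψ` vanishes on torsion.
  -- Surjectivity comes from `lift`.
  criticalGroup≅cyclicProduct : criticalGroup (starGraph (2 + k)) starStructure ≅ cyclicProduct d
  criticalGroup≅cyclicProduct = (λ (x , _) → φ x) , record
    { isGroupMonomorphism = record
      { isGroupHomomorphism = record
        { isMonoidHomomorphism = record
          { isMagmaHomomorphism = record
            { isRelHomomorphism = record { cong = λ {x} {y} → φ-cong x y }
            ; homo = λ (x , _) (y , _) → ≗⇒≈ d _ _ λ i → homo (x _) (x _) (y _) (y _)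
            }
          ; ε-homo = ≗⇒≈ d (φ (λ _ → ℤ.0ℤ)) H.ε λ i → refl
          }
        ; ⁻¹-homo = λ (x , _) → ≗⇒≈ d _ _ λ i → sym (ℤ.neg-distrib-+ (x _) (ℤ.- x _))
        }
      ; injective = λ {(x , p)} {(y , q)} φx≈φy → ψ≡0∧φ∣⇒image (λ v → x v ℤ.- y v)
          (trans (ψ-- x y) (cong₂ ℤ._-_ (torsion⇒ψ≡0 x p) (torsion⇒ψ≡0 y q)))
          λ i → subst (+ d i ℤ.∣_) (sym (φ-- x y i)) (≈⇒∣ d (φ x) (φ y) φx≈φy i)
      }
    ; surjective = λ h → (lift h , lift-torsion h) , λ {x} x≈lift →
        H.trans {φ (proj₁ x)} {φ (lift h)} {h} (φ-cong x (lift h , lift-torsion h) x≈lift)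
          (≗⇒≈ d (φ (lift h)) h λ i → ℤ.+-identityʳ (h i))
    }
    where
    φ-cong : ∀ x y → x K.≈ y → φ (proj₁ x) H.≈ φ (proj₁ y)
    φ-cong (x , _) (y , _) (z , eq) = ∣⇒≈ d (φ x) (φ y) λ i →
      subst (+ d i ℤ.∣_) (φ-- x y i) (image⇒φ∣ z _ eq i)
    homo : ∀ a b c d → (a ℤ.+ c) ℤ.- (b ℤ.+ d) ≡ (a ℤ.- b) ℤ.+ (c ℤ.- d)
    homo = ℤSolver.solve-∀

  cyclicProduct-isCritical : IsCriticalGroup (starGraph (2 + k)) (cyclicProduct d)
  cyclicProduct-isCritical = starStructure ,
    ≅-sym (criticalGroup (starGraph (2 + k)) starStructure) (cyclicProduct d)
      criticalGroup≅cyclicProduct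

-- Counting the classes given by words.

funToFin-cong : ∀ {m n} {f g : Fin m → Fin n} → f ≗ g → funToFin f ≡ funToFin g
funToFin-cong {zero}  f≗g = refl
funToFin-cong {suc m} f≗g = cong₂ combine (f≗g zero) (funToFin-cong (f≗g ∘ suc))

-- Isomorphic word groups give words that agree pointwise; this turns such agreement into equality
-- of their indices.
finToFun-injective : ∀ {m n} {i j : Fin (n ^ m)} → finToFun {n} {m} i ≗ finToFun j → i ≡ j
finToFun-injective {m} {n} {i} {j} eq = trans (sym (funToFin-finToFin {m} {n} i))
  (trans (funToFin-cong eq) (funToFin-finToFin {m} {n} j))

wordGroup : Word k → AbelianGroup 0ℓ 0ℓ
wordGroup w = cyclicProduct (denominator w)

wordGroup-isCritical : (w : Word k) → IsCriticalGroup (starGraph (2 + k)) (wordGroup w)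
wordGroup-isCritical w = cyclicProduct-isCritical d c L s c*d≡L 2+∑c≡s*L
  where
  d = denominator w
  -- Two labels `2 * modulus w` together contribute the reciprocal of `modulus w` that `integral`
  -- asks for. Cofactors relative to `L` double accordingly, and `s` stays the same.
  c = λ i → 2 * cofactor w i
  L = 2 * modulus w
  s = proj₁ (integral w)
  instance _ = m*n≢0 2 (modulus w) {{_}} {{modulus-nonZero w}}

  c*d≡L : ∀ i → c i * d i ≡ L
  c*d≡L i = trans (*-assoc 2 (cofactor w i) (d i)) (cong (2 *_) (cofactor*denominator w i))

  2+∑c≡s*L : 2 + sum c ≡ s * L
  2+∑c≡s*L = begin
    2 + sum c                   ≡⟨ cong (λ t → 2 + t) (*-distribˡ-sum 2 (cofactor w)) ⟨
    2 + 2 * sum (cofactor w)    ≡⟨ *-suc 2 (sum (cofactor w)) ⟨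
    2 * suc (sum (cofactor w))  ≡⟨ cong (2 *_) (proj₂ (integral w)) ⟩
    2 * (s * modulus w)         ≡⟨ swap s (modulus w) ⟩
    s * L                       ∎
    where
    open ≡-Reasoning
    swap : ∀ s m → 2 * (s * m) ≡ s * (2 * m)
    swap = solve-∀

-- The isomorphism and its inverse give divisibility of the moduli and inequality of the orders both
-- ways, so both invariants agree.
wordGroup-injective : (v w : Word k) → wordGroup v ≅ wordGroup w → v ≗ w
wordGroup-injective v w v≅w = word-injective v w
  (∣-antisym (exponent v w v≅w) (exponent w v w≅v))
  (≤-antisym (order-≤ (denominator v) (denominator w) v≅w (denominator-nonZero w))
             (order-≤ (denominator w) (denominator v) w≅v (denominator-nonZero v)))
  where
  w≅v = ≅-sym (wordGroup v) (wordGroup w) v≅w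
  exponent : ∀ v w → wordGroup v ≅ wordGroup w → modulus v ∣ modulus w
  exponent v w v≅w = modulus∣ v
    (exponent-∣ (denominator v) (denominator w) v≅w (denominator∣modulus w))

wordClass : Word k → Setoid.Carrier (CG (starGraph (2 + k)))
wordClass w = wordGroup w , wordGroup-isCritical w

module _ {k : ℕ} where

  open Setoid (CG (starGraph (2 + k))) using (_≈_)

  wordClass-cong : {v w : Word k} → v ≡ w → wordClass v ≈ wordClass w
  wordClass-cong {v} refl = ≅-refl (wordGroup v)

  wordClass-injective : (v w : Word k) → wordClass v ≈ wordClass w → v ≗ w
  wordClass-injective = wordGroup-injective

words↣CG : ∀ k → ∣ CG (starGraph (2 + k)) ∣≥ (2 ^ k)
words↣CG k = record
  { to        = wordClass ∘ word
  ; cong      = λ a≡b → wordClass-cong (cong word a≡b)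
  ; injective = λ {a} {b} a≈b →
      finToFun-injective {k} {2} (wordClass-injective (word a) (word b) a≈b)
  }
  where
  word : Fin (2 ^ k) → Word k
  word = finToFun

proposition27 : (n : ℕ) → 2 ≤ n → ∣ CG (starGraph n) ∣≥ (2 ^ (n ∸ 2))
proposition27 n 2≤n =
  subst (λ m → ∣ CG (starGraph m) ∣≥ (2 ^ (n ∸ 2))) (m+[n∸m]≡n 2≤n) (words↣CG (n ∸ 2))
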